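{- Let $j\ge 3$ and let $\alpha=\alpha_1\cdots\alpha_j$ and $\beta=\beta_1\cdots\beta_j$ be permutations in $S_j$ which are mutually minimal overlapping, and suppose there is $1\le a<j$ such that $\alpha_i=\beta_i$ for all $i\le a$, $\alpha_a=\beta_a=1$, $\alpha_j=\beta_j$, and $\mathrm{des}(\alpha)=\mathrm{des}(\beta)$. Then \[ \sum_{n\ge 0}\frac{t^n}{n!}\sum_{\sigma\in\mathcal{NM}_n(\alpha)} z^{\mathrm{des}(\sigma)}u^{\mathrm{LRmin}(\sigma)}=\sum_{n\ge 0}\frac{t^n}{n!}\sum_{\sigma\in\mathcal{NM}_n(\beta)} z^{\mathrm{des}(\sigma)}u^{\mathrm{LRmin}(\sigma)}, \] so $\alpha$ and $\beta$ are $(\mathrm{des},\mathrm{LRmin})$-c-Wilf equivalent. If in addition $\mathrm{inv}(\alpha)=\mathrm{inv}(\beta)$, then \[ \sum_{n\ge 0}\frac{t^n}{[n]_q!}\sum_{\sigma\in\mathcal{NM}_n(\alpha)} x^{\mathrm{des}(\sigma)}q^{\mathrm{inv}(\sigma)}u^{\mathrm{LRmin}(\sigma)}=\sum_{n\ge 0}\frac{t^n}{[n]_q!}\sum_{\sigma\in\mathcal{NM}_n(\beta)} x^{\mathrm{des}(\sigma)}q^{\mathrm{inv}(\sigma)}u^{\mathrm{LRmin}(\sigma)}, \] so $\alpha$ and $\beta$ are $(\mathrm{des},\mathrm{inv},\mathrm{LRmin})$-c-Wilf equivalent.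
   Context: $S_n$ is the set of permutations $\sigma=\sigma_1\cdots\sigma_n$ of $\{1,\dots,n\}$. $\mathrm{des}(\sigma)=|\{i:\sigma_i>\sigma_{i+1}\}|$, $\mathrm{inv}(\sigma)=|\{(i,k):i<k,\ \sigma_i>\sigma_k\}|$, and $\mathrm{LRmin}(\sigma)$ is the number of left-to-right minima of $\sigma$, i.e. of entries $\sigma_k$ with $\sigma_i>\sigma_k$ for all $i<k$. For a sequence $w$ of distinct positive integers, $\mathrm{red}(w)$ replaces the $i$-th smallest entry by $i$. For $\tau\in S_j$, $\sigma\in S_n$ has a $\tau$-match starting at position $i$ if $\mathrm{red}(\sigma_i\cdots\sigma_{i+j-1})=\tau$; $\tau\text{ - }\mathrm{mch}(\sigma)$ is the number of $\tau$-matches, and $\mathcal{NM}_n(\tau)$ is the set of $\sigma\in S_n$ with no $\tau$-match. $\tau\in S_j$ ($j\ge3$) is minimal overlapping if the smallest $i$ such that some $\sigma\in S_i$ has $\tau\text{ - }\mathrm{mch}(\sigma)=2$ is $2j-1$. Two permutations $\alpha,\beta\in S_j$ are mutually minimal overlapping if both are minimal overlapping and the smallest $n$ such that some $\sigma\in S_n$ has $\alpha\text{ - }\mathrm{mch}(\sigma)\ge1$ and $\beta\text{ - }\mathrm{mch}(\sigma)\ge1$ is $2j-1$. $[n]_q=1+q+\cdots+q^{n-1}$, $[n]_q!=[1]_q\cdots[n]_q$, $[0]_q!=1$. -}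

module Defs where

open import Data.Nat using (ℕ; zero; suc; _+_; _∸_; _<ᵇ_; _≡ᵇ_; _≤_; _<_; _*_)
open import Data.Bool using (Bool; true; false; _∧_; not; if_then_else_)
open import Data.List using (List; []; _∷_; length; map; concatMap; filterᵇ; take; drop; upTo; foldr; reverse)
open import Data.List.Membership.Propositional using (_∈_)
open import Data.Product using (Σ; _×_; ∃-syntax)
open import Relation.Binary.PropositionalEquality using (_≡_; _≢_)

-- Sequences (permutations) are lists of positive naturals, σ = σ₁ ⋯ σₙ.

oneTo : ℕ → List ℕ
oneTo n = map suc (upTo n)

seqs : ℕ → ℕ → List (List ℕ)
seqs n zero    = [] ∷ []
seqs n (suc k) = concatMap (λ x → map (x ∷_) (seqs n k)) (oneTo n)

elemᵇ : ℕ → List ℕ → Bool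
elemᵇ x []       = false
elemᵇ x (y ∷ ys) = if x ≡ᵇ y then true else elemᵇ x ys

distinctᵇ : List ℕ → Bool
distinctᵇ []       = true
distinctᵇ (x ∷ xs) = not (elemᵇ x xs) ∧ distinctᵇ xs

S : ℕ → List (List ℕ)
S n = filterᵇ distinctᵇ (seqs n n)

countᵇ : {A : Set} → (A → Bool) → List A → ℕ
countᵇ p xs = length (filterᵇ p xs)

des : List ℕ → ℕ
des []           = 0
des (x ∷ [])     = 0
des (x ∷ y ∷ ys) = (if y <ᵇ x then 1 else 0) + des (y ∷ ys)

inv : List ℕ → ℕ
inv []       = 0
inv (x ∷ xs) = countᵇ (λ y → y <ᵇ x) xs + inv xs

allGreater : ℕ → List ℕ → Bool
allGreater x []       = true
allGreater x (y ∷ ys) = (x <ᵇ y) ∧ allGreater x ys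

lrminAux : List ℕ → List ℕ → ℕ
lrminAux pre []       = 0
lrminAux pre (x ∷ xs) = (if allGreater x pre then 1 else 0) + lrminAux (x ∷ pre) xs

LRmin : List ℕ → ℕ
LRmin = lrminAux []

-- red w : replace the i-th smallest entry by i (entry x ↦ 1 + #{entries < x})
red : List ℕ → List ℕ
red w = map (λ x → suc (countᵇ (λ y → y <ᵇ x) w)) w

listEqᵇ : List ℕ → List ℕ → Bool
listEqᵇ []       []       = true
listEqᵇ (x ∷ xs) (y ∷ ys) = (x ≡ᵇ y) ∧ listEqᵇ xs ys
listEqᵇ _        _        = false

-- τ-mch σ: a match starts at 0-based position i iff the window σᵢ₊₁⋯σᵢ₊ⱼ has full length j and reduces to τ
fullMatchᵇ : List ℕ → List ℕ → ℕ → Bool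
fullMatchᵇ τ σ i = (length (take (length τ) (drop i σ)) ≡ᵇ length τ)
                   ∧ listEqᵇ (red (take (length τ) (drop i σ))) τ

_-mch_ : List ℕ → List ℕ → ℕ
τ -mch σ = countᵇ (fullMatchᵇ τ σ) (upTo (length σ))

noMatchᵇ : List ℕ → List ℕ → Bool
noMatchᵇ τ σ = (τ -mch σ) ≡ᵇ 0

-- 1-indexed entry access (0 if out of range)
_!_ : List ℕ → ℕ → ℕ
[]       ! _           = 0
(x ∷ xs) ! zero        = 0
(x ∷ xs) ! suc zero    = x
(x ∷ xs) ! suc (suc i) = xs ! suc i

MinimalOverlapping : ℕ → List ℕ → Set
MinimalOverlapping j τ =
  (∃[ σ ] (σ ∈ S (2 * j ∸ 1) × τ -mch σ ≡ 2))
  × (∀ i → i < 2 * j ∸ 1 → ∀ σ → σ ∈ S i → τ -mch σ ≢ 2)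

MutuallyMinimalOverlapping : ℕ → List ℕ → List ℕ → Set
MutuallyMinimalOverlapping j α β =
  MinimalOverlapping j α × MinimalOverlapping j β
  × (∃[ σ ] (σ ∈ S (2 * j ∸ 1) × 1 ≤ α -mch σ × 1 ≤ β -mch σ))
  × (∀ n → n < 2 * j ∸ 1 → ∀ σ → σ ∈ S n → 1 ≤ α -mch σ → 1 ≤ β -mch σ → Data.Empty.⊥)
  where import Data.Empty

-- coefficient of t^n/n! · z^d u^l in Σ_n t^n/n! Σ_{σ∈NM_n(τ)} z^des u^LRmin
coeffDesLR : List ℕ → ℕ → ℕ → ℕ → ℕ
coeffDesLR τ n d l =
  countᵇ (λ σ → noMatchᵇ τ σ ∧ (des σ ≡ᵇ d) ∧ (LRmin σ ≡ᵇ l)) (S n)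

-- coefficient of t^n/[n]_q! · x^d q^k u^l in Σ_n t^n/[n]_q! Σ_{σ∈NM_n(τ)} x^des q^inv u^LRmin
coeffDesInvLR : List ℕ → ℕ → ℕ → ℕ → ℕ → ℕ
coeffDesInvLR τ n d k l =
  countᵇ (λ σ → noMatchᵇ τ σ ∧ (des σ ≡ᵇ d) ∧ (inv σ ≡ᵇ k) ∧ (LRmin σ ≡ᵇ l)) (S n)

{-# OPTIONS --safe #-}

-- Exchange the arrangement α for β (or β for α) in the window at one fixed position k, leaving all other
-- permutations alone. This is an involution of S n. The exchange keeps the first and last entries of the
-- window, and matches of α and β overlap in at most one entry, so the matches at the other positions are
-- unaffected, while those of α and β at k trade places. Doing this for k = 0, 1, …, n ∸ 1 turns the count of
-- permutations avoiding α into the count of those avoiding β, one position at a time. The exchange happens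
-- after the minimum of the window, hence preserves left-to-right minima; des and inv are immediate.
module Submission where

open import Defs
open import Data.Bool using (Bool; true; false; _∧_; not; if_then_else_; T)
open import Data.Bool.Properties using (T-≡; T-∧; T?)
open import Data.Empty using (⊥; ⊥-elim)
open import Data.List
  using (cartesianProductWith; List; []; _∷_; _++_; length; map; filterᵇ; take; drop; upTo; concatMap)
open import Data.List.Membership.Propositional using (_∈_)
open import Data.List.Membership.Propositional.Properties
  using (∈-cartesianProductWith⁺; ∈-cartesianProductWith⁻; ∈-length; ∈-filter⁺; ∈-filter⁻; ∈-map⁺; ∈-map⁻;
    ∈-++⁺ˡ; ∈-++⁺ʳ; ∈-∃++; ∈-insert; ∈-upTo⁺; ∈-upTo⁻)
open import Data.List.Membership.Propositional.Properties.WithK using (unique∧set⇒bag)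
open import Data.List.Properties
  using (map-++; length-++-≤ˡ; ≡-dec; ∷-injective; filter-++; length-++; length-map; map-id-local; map-∘;
    map-cong-local; take-map; drop-map; take-take; take-drop; drop-drop; length-take; length-drop;
    take++drop≡id; filter-notAll; length-upTo; ++-assoc)
open import Data.List.Relation.Binary.BagAndSetEquality using (∼bag⇒↭)
open import Data.List.Relation.Binary.Permutation.Propositional
  using (_↭_; ↭-refl; ↭-sym; ↭-trans; ↭-prep; ↭-reflexive; ↭⇒↭ₛ)
open import Data.List.Relation.Binary.Permutation.Propositional.Properties
  using (filter-↭; ↭-length; ∈-resp-↭; ++⁺ˡ; ++⁺ʳ; shift; All-resp-↭) renaming (map⁺ to ↭-map⁺)
open import Data.List.Relation.Unary.All using (All; []; _∷_)
import Data.List.Relation.Unary.All as All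
open import Data.List.Relation.Unary.All.Properties using (++⁻ʳ) renaming (map⁺ to All-map⁺)
open import Data.List.Relation.Unary.AllPairs using ([]; _∷_)
open import Data.List.Relation.Unary.Any using (here; there)
import Data.List.Relation.Unary.Any as Any
open import Data.List.Relation.Unary.Unique.Propositional using (Unique)
import Data.List.Relation.Unary.Unique.Propositional.Properties as Unique
open import Data.Nat using (ℕ; zero; suc; _+_; _*_; _∸_; _≤_; _<_; _<ᵇ_; _≡ᵇ_; z≤n; s≤s; s≤s⁻¹; _⊓_)
open import Data.Nat.Induction using (<-rec)
open import Data.Nat.Properties
open import Data.Product using (_×_; _,_; proj₁; proj₂; ∃-syntax)
open import Data.Sum using (inj₁; inj₂)
open import Function using (_∘_; id; mk⇔; Equivalence)
open import Relation.Binary.Definitions using (tri<; tri≈; tri>)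
open import Relation.Binary.PropositionalEquality
open import Relation.Nullary using (¬_; yes; no; contradiction)
open import Data.List.Relation.Binary.Permutation.Setoid.Properties (setoid ℕ) using (Unique-resp-↭)
open import Algebra.Properties.CommutativeSemigroup +-commutativeSemigroup using (x∙yz≈y∙xz)

-- A single pass over all matches would have to rewrite chains of windows that share end entries
-- simultaneously. At one fixed position only one window is rewritten, and the involution is visible
-- from that window alone. The price is a mixed condition in the intermediate counts: no β at
-- positions below k and no α at positions from k on. It is a conjunction over positions, and the
-- exchange at k affects only the conjunct at k.
--
-- Minimal overlapping speaks of the number of matches in whole permutations of bounded length,
-- while the exchange needs a local fact: no two matches start at a positive distance below j - 1.
-- The link is the reduction of the stretch spanned by two matches. For one α-match and one β-match
-- the same argument also works at distance 0, which shows that α and β differ.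
--
-- The series are compared coefficientwise, so any Boolean condition that the exchanges respect can
-- be carried along.

private variable
  A B : Set
  x y n : ℕ
  u v w ρ σ τ : List ℕ

-- Counting with Boolean predicates

T⇒≡true : ∀ {b} → T b → b ≡ true
T⇒≡true = Equivalence.to T-≡

⇔⇒≡ : ∀ {b c} → (T b → T c) → (T c → T b) → b ≡ c
⇔⇒≡ {false} {false} f g = refl
⇔⇒≡ {false} {true}  f g = ⊥-elim (g _)
⇔⇒≡ {true}  {false} f g = ⊥-elim (f _)
⇔⇒≡ {true}  {true}  f g = refl

𝟙 : Bool → ℕ
𝟙 b = if b then 1 else 0

countᵇ-∷ : (p : A → Bool) (a : A) (as : List A) → countᵇ p (a ∷ as) ≡ 𝟙 (p a) + countᵇ p as
countᵇ-∷ p a as with p a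
... | true  = refl
... | false = refl

countᵇ-++ : (p : A → Bool) (as bs : List A) → countᵇ p (as ++ bs) ≡ countᵇ p as + countᵇ p bs
countᵇ-++ p as bs = trans (cong length (filter-++ (T? ∘ p) as bs)) (length-++ (filterᵇ p as))

countᵇ-↭ : (p : A → Bool) {as bs : List A} → as ↭ bs → countᵇ p as ≡ countᵇ p bs
countᵇ-↭ p π = ↭-length (filter-↭ (T? ∘ p) π)

countᵇ-cong : {p q : A → Bool} (as : List A) → (∀ {a} → a ∈ as → p a ≡ q a) → countᵇ p as ≡ countᵇ q as
countᵇ-cong []       h = refl
countᵇ-cong {p = p} {q} (a ∷ as) h = begin
  countᵇ p (a ∷ as)          ≡⟨ countᵇ-∷ p a as ⟩
  𝟙 (p a) + countᵇ p as      ≡⟨ cong₂ (λ b c → 𝟙 b + c) (h (here refl)) (countᵇ-cong as (h ∘ there)) ⟩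
  𝟙 (q a) + countᵇ q as      ≡⟨ countᵇ-∷ q a as ⟨
  countᵇ q (a ∷ as)          ∎
  where open ≡-Reasoning

countᵇ-map : (p : B → Bool) (f : A → B) (as : List A) → countᵇ p (map f as) ≡ countᵇ (p ∘ f) as
countᵇ-map p f []       = refl
countᵇ-map p f (a ∷ as) = begin
  countᵇ p (f a ∷ map f as)            ≡⟨ countᵇ-∷ p (f a) (map f as) ⟩
  𝟙 (p (f a)) + countᵇ p (map f as)    ≡⟨ cong (𝟙 (p (f a)) +_) (countᵇ-map p f as) ⟩
  𝟙 (p (f a)) + countᵇ (p ∘ f) as      ≡⟨ countᵇ-∷ (p ∘ f) a as ⟨
  countᵇ (p ∘ f) (a ∷ as)              ∎
  where open ≡-Reasoning

𝟙-mono : ∀ {b c} → (T b → T c) → 𝟙 b ≤ 𝟙 c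
𝟙-mono {false}         f = z≤n
𝟙-mono {true}  {true}  f = ≤-refl
𝟙-mono {true}  {false} f = ⊥-elim (f _)

countᵇ-mono : {p q : A → Bool} (as : List A) → (∀ {a} → T (p a) → T (q a)) → countᵇ p as ≤ countᵇ q as
countᵇ-mono []       h = z≤n
countᵇ-mono {p = p} {q} (a ∷ as) h = begin
  countᵇ p (a ∷ as)      ≡⟨ countᵇ-∷ p a as ⟩
  𝟙 (p a) + countᵇ p as  ≤⟨ +-mono-≤ (𝟙-mono h) (countᵇ-mono as h) ⟩
  𝟙 (q a) + countᵇ q as  ≡⟨ countᵇ-∷ q a as ⟨
  countᵇ q (a ∷ as)      ∎
  where open ≤-Reasoning

countᵇ-mono-< : {p q : A → Bool} {as : List A} → (∀ {a} → T (p a) → T (q a)) →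
  ∀ {b} → b ∈ as → ¬ T (p b) → T (q b) → countᵇ p as < countᵇ q as
countᵇ-mono-< {p = p} {q} {a ∷ as} h (here refl) ¬pb qb with p a | q a
... | true  | _    = contradiction _ ¬pb
... | false | true = s≤s (countᵇ-mono as h)
countᵇ-mono-< {p = p} {q} {a ∷ as} h (there b∈) ¬pb qb = begin-strict
  countᵇ p (a ∷ as)      ≡⟨ countᵇ-∷ p a as ⟩
  𝟙 (p a) + countᵇ p as  <⟨ +-mono-≤-< (𝟙-mono h) (countᵇ-mono-< h b∈ ¬pb qb) ⟩
  𝟙 (q a) + countᵇ q as  ≡⟨ countᵇ-∷ q a as ⟨
  countᵇ q (a ∷ as)      ∎
  where open ≤-Reasoning

-- Ranks, reduction and rearrangement by a pattern

rank : List ℕ → ℕ → ℕ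
rank w x = suc (countᵇ (λ y → y <ᵇ x) w)

rank-↭ : v ↭ w → ∀ x → rank v x ≡ rank w x
rank-↭ π x = cong suc (countᵇ-↭ _ π)

rank-mono-≤ : ∀ w → x ≤ y → rank w x ≤ rank w y
rank-mono-≤ {x} {y} w x≤y = s≤s (countᵇ-mono w λ {a} a<x → <⇒<ᵇ (<-≤-trans (<ᵇ⇒< a x a<x) x≤y))

-- Strictness is due to `x` itself: it is an entry below `y` but not below `x`.
rank-mono-< : x ∈ w → x < y → rank w x < rank w y
rank-mono-< {x} {w} {y} x∈w x<y = s≤s (countᵇ-mono-<
  (λ {a} a<x → <⇒<ᵇ (<-trans (<ᵇ⇒< a x a<x) x<y)) x∈w (λ x<x → <-irrefl refl (<ᵇ⇒< x x x<x)) (<⇒<ᵇ x<y))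

rank-cancel-< : ∀ w → rank w x < rank w y → x < y
rank-cancel-< w r = ≰⇒> λ y≤x → <⇒≱ r (rank-mono-≤ w y≤x)

rank-injective : x ∈ w → y ∈ w → rank w x ≡ rank w y → x ≡ y
rank-injective {x} {w} {y} x∈w y∈w eq with <-cmp x y
... | tri< x<y _ _ = contradiction eq (<⇒≢ (rank-mono-< x∈w x<y))
... | tri≈ _ x≡y _ = x≡y
... | tri> _ _ y<x = contradiction (sym eq) (<⇒≢ (rank-mono-< y∈w y<x))

-- `des`, `inv` and `red` consult entries only through `_<ᵇ_`, so agreement of the Boolean tests is
-- exactly what they need. It is asked only on entries of `w`, since `rank w` need not be strictly
-- increasing elsewhere.
OrderPreserving : (ℕ → ℕ) → List ℕ → Set
OrderPreserving f w = ∀ {x y} → x ∈ w → y ∈ w → (f x <ᵇ f y) ≡ (x <ᵇ y)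

rank-orderPreserving : ∀ w → OrderPreserving (rank w) w
rank-orderPreserving w {x} {y} x∈w y∈w = ⇔⇒≡
  (λ r → <⇒<ᵇ (rank-cancel-< {x} {y} w (<ᵇ⇒< (rank w x) (rank w y) r)))
  (λ r → <⇒<ᵇ (rank-mono-< x∈w (<ᵇ⇒< x y r)))

module _ {f : ℕ → ℕ} where

  des-map : ∀ w → OrderPreserving f w → des (map f w) ≡ des w
  des-map []          h = refl
  des-map (x ∷ [])    h = refl
  des-map (x ∷ y ∷ w) h =
    cong₂ (λ b c → 𝟙 b + c) (h (there (here refl)) (here refl))
      (des-map (y ∷ w) λ x∈ y∈ → h (there x∈) (there y∈))

  inv-map : ∀ w → OrderPreserving f w → inv (map f w) ≡ inv w
  inv-map []      h = refl
  inv-map (x ∷ w) h = cong₂ _+_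
    (trans (countᵇ-map _ f w) (countᵇ-cong w λ y∈ → h (there y∈) (here refl)))
    (inv-map w λ x∈ y∈ → h (there x∈) (there y∈))

  red-map : ∀ w → OrderPreserving f w → red (map f w) ≡ red w
  red-map w h = trans (sym (map-∘ w)) (map-cong-local (All.tabulate λ x∈ →
    cong suc (trans (countᵇ-map _ f w) (countᵇ-cong w λ y∈ → h y∈ x∈))))

des-red : ∀ w → des (red w) ≡ des w
des-red w = des-map w (rank-orderPreserving w)

inv-red : ∀ w → inv (red w) ≡ inv w
inv-red w = inv-map w (rank-orderPreserving w)

headOrZero : List ℕ → ℕ
headOrZero []      = 0
headOrZero (x ∷ _) = x

headOrZero-∈ : x ∈ w → headOrZero w ∈ w
headOrZero-∈ (here _)  = here refl
headOrZero-∈ (there _) = here refl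

-- The inverse of `rank w` on the entries of `w`. The default 0 arises only when `b` is not the rank
-- of an entry.
select : List ℕ → ℕ → ℕ
select w b = headOrZero (filterᵇ (λ x → rank w x ≡ᵇ b) w)

select-rank : x ∈ w → select w (rank w x) ≡ x
select-rank {x} {w} x∈w = rank-injective (proj₁ s∈) x∈w (≡ᵇ⇒≡ _ _ (proj₂ s∈))
  where
  P? = λ y → T? (rank w y ≡ᵇ rank w x)
  s∈ = ∈-filter⁻ P? {xs = w} (headOrZero-∈ (∈-filter⁺ P? x∈w (≡⇒≡ᵇ (rank w x) (rank w x) refl)))

rank-select : x ∈ red w → rank w (select w x) ≡ x
rank-select {w = w} x∈ with y , y∈w , refl ← ∈-map⁻ (rank w) x∈ = cong (rank w) (select-rank y∈w)

arrange : List ℕ → List ℕ → List ℕ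
arrange ρ w = map (select w) ρ

-- Ranks depend on the entries only as a multiset, so looking up in `v` the ranks computed in `w`
-- returns `w`. With `v` equal to `w` an unchanged pattern leaves a window alone; with `v` the
-- rewritten window this undoes an exchange.
arrange-red : v ↭ w → arrange (red w) v ≡ w
arrange-red {v} {w} π = trans (sym (map-∘ w)) (map-id-local (All.tabulate λ {x} x∈w →
  trans (cong (select v) (rank-↭ (↭-sym π) x)) (select-rank (∈-resp-↭ (↭-sym π) x∈w))))

module _ {ρ w : List ℕ} (π : ρ ↭ red w) where

  arrange-↭ : arrange ρ w ↭ w
  arrange-↭ = ↭-trans (↭-map⁺ (select w) π) (↭-reflexive (arrange-red ↭-refl))

  red-arrange : red (arrange ρ w) ≡ ρ
  red-arrange = trans (sym (map-∘ ρ)) (map-id-local (All.tabulate λ {x} x∈ρ →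
    trans (rank-↭ arrange-↭ (select w x)) (rank-select {w = w} (∈-resp-↭ π x∈ρ))))

-- Statistics of concatenations

-- The cut goes through the entry `x`, which belongs to both pieces, so each adjacent pair lies in
-- exactly one of them.
des-++ : ∀ w x v → des (w ++ x ∷ v) ≡ des (w ++ x ∷ []) + des (x ∷ v)
des-++ []          x v = refl
des-++ (y ∷ [])    x v = cong (_+ des (x ∷ v)) (sym (+-identityʳ _))
des-++ (y ∷ z ∷ w) x v = trans (cong (𝟙 (z <ᵇ y) +_) (des-++ (z ∷ w) x v)) (sym (+-assoc (𝟙 (z <ᵇ y)) _ _))

-- The inversions between two consecutive blocks. They do not depend on the order inside either
-- block, so rearranging a window affects `inv` only through the inversions within the window.
cross : List ℕ → List ℕ → ℕ
cross []      v = 0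
cross (x ∷ w) v = countᵇ (λ y → y <ᵇ x) v + cross w v

cross-↭ʳ : ∀ u → v ↭ w → cross u v ≡ cross u w
cross-↭ʳ []      π = refl
cross-↭ʳ (x ∷ u) π = cong₂ _+_ (countᵇ-↭ _ π) (cross-↭ʳ u π)

open _↭_ using (prep; swap)

cross-↭ˡ : v ↭ w → ∀ u → cross v u ≡ cross w u
cross-↭ˡ _↭_.refl          u = refl
cross-↭ˡ (prep x π)    u = cong (countᵇ (λ y → y <ᵇ x) u +_) (cross-↭ˡ π u)
cross-↭ˡ (swap x y π)  u rewrite cross-↭ˡ π u =
  x∙yz≈y∙xz (countᵇ (λ z → z <ᵇ x) u) (countᵇ (λ z → z <ᵇ y) u) _
cross-↭ˡ (_↭_.trans π₁ π₂) u = trans (cross-↭ˡ π₁ u) (cross-↭ˡ π₂ u)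

inv-++ : ∀ w v → inv (w ++ v) ≡ inv w + (cross w v + inv v)
inv-++ []      v = refl
inv-++ (x ∷ w) v = begin
  c (w ++ v) + inv (w ++ v)                       ≡⟨ cong₂ _+_ (countᵇ-++ _ w v) (inv-++ w v) ⟩
  (c w + c v) + (inv w + (cross w v + inv v))     ≡⟨ shuffle (c w) (c v) (inv w) (cross w v) (inv v) ⟩
  (c w + inv w) + ((c v + cross w v) + inv v)     ∎
  where
  open ≡-Reasoning
  c = countᵇ (λ y → y <ᵇ x)
  open import Data.Nat.Tactic.RingSolver using (solve-∀)
  shuffle : ∀ a b d e f → (a + b) + (d + (e + f)) ≡ (a + d) + ((b + e) + f)
  shuffle = solve-∀

inv-++-congˡ : ∀ u → v ↭ w → inv v ≡ inv w → inv (u ++ v) ≡ inv (u ++ w)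
inv-++-congˡ {v} {w} u π eq = trans (inv-++ u v)
  (trans (cong (inv u +_) (cong₂ _+_ (cross-↭ʳ u π) eq)) (sym (inv-++ u w)))

inv-++-congʳ : ∀ u → v ↭ w → inv v ≡ inv w → inv (v ++ u) ≡ inv (w ++ u)
inv-++-congʳ {v} {w} u π eq = trans (inv-++ v u)
  (trans (cong₂ (λ a b → a + (b + inv u)) eq (cross-↭ˡ π u)) (sym (inv-++ w u)))

allGreater-↭ : ∀ x → v ↭ w → allGreater x v ≡ allGreater x w
allGreater-↭ x _↭_.refl         = refl
allGreater-↭ x (prep y π)   = cong ((x <ᵇ y) ∧_) (allGreater-↭ x π)
allGreater-↭ x (swap y z π) rewrite allGreater-↭ x π with x <ᵇ y | x <ᵇ z
... | true  | true  = refl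
... | true  | false = refl
... | false | true  = refl
... | false | false = refl
allGreater-↭ x (_↭_.trans π₁ π₂) = trans (allGreater-↭ x π₁) (allGreater-↭ x π₂)

lrminAux-↭ : v ↭ w → ∀ u → lrminAux v u ≡ lrminAux w u
lrminAux-↭ π []      = refl
lrminAux-↭ π (x ∷ u) = cong₂ (λ b c → 𝟙 b + c) (allGreater-↭ x π) (lrminAux-↭ (prep x π) u)

-- The recursion really accumulates `w` in reverse; since the accumulator is only tested by
-- `allGreater`, its order may be ignored.
lrminAux-++ : ∀ pre w v → lrminAux pre (w ++ v) ≡ lrminAux pre w + lrminAux (w ++ pre) v
lrminAux-++ pre []      v = refl
lrminAux-++ pre (x ∷ w) v = begin
  𝟙 g + lrminAux (x ∷ pre) (w ++ v)                                    ≡⟨ cong (𝟙 g +_) (lrminAux-++ (x ∷ pre) w v) ⟩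
  𝟙 g + (lrminAux (x ∷ pre) w + lrminAux (w ++ x ∷ pre) v)             ≡⟨ sym (+-assoc (𝟙 g) _ _) ⟩
  𝟙 g + lrminAux (x ∷ pre) w + lrminAux (w ++ x ∷ pre) v               ≡⟨ cong (𝟙 g + lrminAux (x ∷ pre) w +_) (lrminAux-↭ (shift x w pre) v) ⟩
  𝟙 g + lrminAux (x ∷ pre) w + lrminAux (x ∷ w ++ pre) v               ∎
  where
  open ≡-Reasoning
  g = allGreater x pre

allGreater-∈ : x ∈ w → T (allGreater y w) → y < x
allGreater-∈ {x} {_} {y} (here refl) g = <ᵇ⇒< y x (proj₁ (Equivalence.to T-∧ g))
allGreater-∈ {x} {z ∷ w} {y} (there x∈) g = allGreater-∈ x∈ (proj₂ (Equivalence.to (T-∧ {y <ᵇ z}) g))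

-- A new left-to-right minimum would have to lie strictly below `c`, which has already been seen.
lrminAux-≥ : ∀ {c pre} → c ∈ pre → All (c ≤_) w → lrminAux pre w ≡ 0
lrminAux-≥ {[]}    c∈ []       = refl
lrminAux-≥ {x ∷ w} {c} {pre} c∈ (c≤x ∷ h) with allGreater x pre in eq
... | false = lrminAux-≥ (there c∈) h
... | true  = contradiction (allGreater-∈ c∈ (Equivalence.from T-≡ eq)) (≤⇒≯ c≤x)

-- Membership in the list of permutations

seqs-cartesian : ∀ n k → seqs n (suc k) ≡ cartesianProductWith _∷_ (oneTo n) (seqs n k)
seqs-cartesian n k = go (oneTo n)
  where
  go : ∀ as → concatMap (λ x → map (x ∷_) (seqs n k)) as ≡ cartesianProductWith _∷_ as (seqs n k)
  go []       = refl
  go (a ∷ as) = cong (map (a ∷_) (seqs n k) ++_) (go as)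

∈-seqs⁺ : All (_∈ oneTo n) w → w ∈ seqs n (length w)
∈-seqs⁺ [] = here refl
∈-seqs⁺ {n} {x ∷ w} (x∈ ∷ w⊆) = subst (_ ∈_) (sym (seqs-cartesian n (length w)))
  (∈-cartesianProductWith⁺ _∷_ x∈ (∈-seqs⁺ w⊆))

∈-seqs⁻ : ∀ k → w ∈ seqs n k → length w ≡ k × All (_∈ oneTo n) w
∈-seqs⁻ zero (here refl) = refl , []
∈-seqs⁻ {n = n} (suc k) w∈
  with x , w , x∈ , w∈ , refl ← ∈-cartesianProductWith⁻ _∷_ (oneTo n) (seqs n k)
         (subst (_ ∈_) (seqs-cartesian n k) w∈)
  with len , w⊆ ← ∈-seqs⁻ k w∈ = cong suc len , x∈ ∷ w⊆

oneTo-unique : ∀ n → Unique (oneTo n)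
oneTo-unique n = Unique.map⁺ suc-injective (Unique.upTo⁺ n)

seqs-unique : ∀ n k → Unique (seqs n k)
seqs-unique n zero    = [] ∷ []
seqs-unique n (suc k) = subst Unique (sym (seqs-cartesian n k))
  (Unique.cartesianProductWith⁺ _∷_ ∷-injective (oneTo-unique n) (seqs-unique n k))

∈⇒elemᵇ : x ∈ w → elemᵇ x w ≡ true
∈⇒elemᵇ {x} {y ∷ w} x∈ with x ≡ᵇ y in eq
∈⇒elemᵇ             x∈          | true  = refl
∈⇒elemᵇ {x} {y ∷ w} (here refl) | false = contradiction (trans (sym eq) (T⇒≡true (≡⇒≡ᵇ x x refl))) λ ()
∈⇒elemᵇ             (there x∈)  | false = ∈⇒elemᵇ x∈

elemᵇ⇒∈ : ∀ w → elemᵇ x w ≡ true → x ∈ w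
elemᵇ⇒∈ {x} (y ∷ w) e with x ≡ᵇ y in eq
... | true  = here (≡ᵇ⇒≡ x y (Equivalence.from T-≡ eq))
... | false = there (elemᵇ⇒∈ w e)

distinctᵇ⇒Unique : ∀ w → T (distinctᵇ w) → Unique w
distinctᵇ⇒Unique []      _ = []
distinctᵇ⇒Unique (x ∷ w) d with elemᵇ x w in eq
... | false = All.tabulate (λ y∈ x≡y → contradiction (trans (sym eq) (∈⇒elemᵇ (subst (_∈ w) (sym x≡y) y∈))) λ ())
              ∷ distinctᵇ⇒Unique w d

Unique⇒distinctᵇ : Unique w → T (distinctᵇ w)
Unique⇒distinctᵇ [] = _
Unique⇒distinctᵇ {x ∷ w} u@(_ ∷ u′) with elemᵇ x w in eq
... | true  = contradiction (elemᵇ⇒∈ w eq) (Unique.Unique[x∷xs]⇒x∉xs u)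
... | false = Unique⇒distinctᵇ u′

∈-S⁺ : length σ ≡ n → All (_∈ oneTo n) σ → Unique σ → σ ∈ S n
∈-S⁺ refl σ⊆ u = ∈-filter⁺ (T? ∘ distinctᵇ) (∈-seqs⁺ σ⊆) (Unique⇒distinctᵇ u)

∈-S⁻ : ∀ n → σ ∈ S n → length σ ≡ n × All (_∈ oneTo n) σ × Unique σ
∈-S⁻ {σ} n σ∈ with ∈-filter⁻ (T? ∘ distinctᵇ) {xs = seqs n n} σ∈
... | σ∈seqs , d with ∈-seqs⁻ n σ∈seqs
... | len , σ⊆ = len , σ⊆ , distinctᵇ⇒Unique σ d

S-unique : ∀ n → Unique (S n)
S-unique n = Unique.filter⁺ (T? ∘ distinctᵇ) (seqs-unique n n)

∈S⇒Unique : ∀ n → σ ∈ S n → Unique σ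
∈S⇒Unique n = proj₂ ∘ proj₂ ∘ ∈-S⁻ n

∈S-resp-↭ : ∀ n → σ ↭ τ → σ ∈ S n → τ ∈ S n
∈S-resp-↭ n π σ∈ with len , σ⊆ , u ← ∈-S⁻ n σ∈ =
  ∈-S⁺ (trans (sym (↭-length π)) len) (All-resp-↭ π σ⊆) (Unique-resp-↭ (↭⇒↭ₛ π) u)

-- Pigeonhole: delete from `bs` an occurrence of the head of `as`. The tail of `as` stays inside
-- what is left because the head does not recur in it.
⊆∧≥⇒↭ : {as bs : List A} → Unique as → (∀ {a} → a ∈ as → a ∈ bs) → length bs ≤ length as → as ↭ bs
⊆∧≥⇒↭ {as = []}     {[]} _ _ _ = ↭-refl
⊆∧≥⇒↭ {as = a ∷ as} u@(_ ∷ u′) ⊆ ≥ with ys , zs , refl ← ∈-∃++ (⊆ (here refl)) =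
  ↭-trans (↭-prep a (⊆∧≥⇒↭ u′ ⊆′ (s≤s⁻¹ (subst (_≤ _) (↭-length (shift a ys zs)) ≥))))
          (↭-sym (shift a ys zs))
  where
  ⊆′ : ∀ {b} → b ∈ as → b ∈ ys ++ zs
  ⊆′ b∈ with ∈-resp-↭ (shift a ys zs) (⊆ (there b∈))
  ... | here refl = contradiction b∈ (Unique.Unique[x∷xs]⇒x∉xs u)
  ... | there b∈′ = b∈′

S⇒↭oneTo : ∀ n → σ ∈ S n → σ ↭ oneTo n
S⇒↭oneTo n σ∈ with len , σ⊆ , u ← ∈-S⁻ n σ∈ =
  ⊆∧≥⇒↭ u (All.lookup σ⊆) (≤-reflexive (trans (trans (length-map suc (upTo n)) (length-upTo n)) (sym len)))

∈-oneTo⁺ : ∀ {x} → x < n → suc x ∈ oneTo n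
∈-oneTo⁺ x<n = ∈-map⁺ suc (∈-upTo⁺ x<n)

Unique-map : ∀ {f : A → B} {as} → (∀ {a b} → a ∈ as → b ∈ as → f a ≡ f b → a ≡ b) →
  Unique as → Unique (map f as)
Unique-map inj []       = []
Unique-map inj (a∉ ∷ u) =
  All-map⁺ (All.tabulate λ b∈ fa≡fb → All.lookup a∉ b∈ (inj (here refl) (there b∈) fa≡fb))
  ∷ Unique-map (λ a∈ b∈ → inj (there a∈) (there b∈)) u

red-∈S : Unique w → red w ∈ S (length w)
red-∈S {w} u = ∈-S⁺ (length-map (rank w) w)
  (All-map⁺ (All.tabulate λ {x} x∈ → ∈-oneTo⁺
    -- An entry is not below itself, so fewer than `length w` entries are counted and the rank is at
    -- most `length w`.
    (filter-notAll (λ y → T? (y <ᵇ x)) w (Any.map (λ { refl x<x → <-irrefl refl (<ᵇ⇒< x x x<x) }) x∈))))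
  (Unique-map (rank-injective {w = w}) u)

unique∧set⇒↭ : {as bs : List A} → Unique as → Unique bs →
  (∀ {a} → a ∈ as → a ∈ bs) → (∀ {a} → a ∈ bs → a ∈ as) → as ↭ bs
unique∧set⇒↭ u u′ f g = ∼bag⇒↭ (unique∧set⇒bag u u′ (mk⇔ f g))

-- Being its own inverse on `as`, `f` only permutes the list, so counting over `map f as` is
-- counting over `as`.
countᵇ-involution : (p : A → Bool) (f : A → A) {as : List A} → Unique as →
  (∀ {a} → a ∈ as → f a ∈ as) → (∀ {a} → a ∈ as → f (f a) ≡ a) →
  countᵇ p as ≡ countᵇ (p ∘ f) as
countᵇ-involution p f {as} u closed inv =
  trans (countᵇ-↭ p (unique∧set⇒↭ u u-map
          (λ a∈ → subst (_∈ map f as) (inv a∈) (∈-map⁺ f (closed a∈)))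
          (λ b∈ → let a , a∈ , eq = ∈-map⁻ f b∈ in subst (_∈ as) (sym eq) (closed a∈))))
        (countᵇ-map p f as)
  where
  u-map = Unique-map (λ a∈ b∈ eq → trans (sym (inv a∈)) (trans (cong f eq) (inv b∈))) u

-- Windows and matches

window : ℕ → ℕ → List ℕ → List ℕ
window j i σ = take j (drop i σ)

-- The length test of `fullMatchᵇ` is absorbed: `red` preserves length, so a truncated window cannot
-- reduce to a pattern of length `j`.
Match : ℕ → List ℕ → List ℕ → ℕ → Set
Match j τ σ i = red (window j i σ) ≡ τ

listEqᵇ⇒≡ : ∀ v w → T (listEqᵇ v w) → v ≡ w
listEqᵇ⇒≡ []      []      _ = refl
listEqᵇ⇒≡ (x ∷ v) (y ∷ w) e with x≡y , v≡w ← Equivalence.to (T-∧ {x ≡ᵇ y}) e =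
  cong₂ _∷_ (≡ᵇ⇒≡ x y x≡y) (listEqᵇ⇒≡ v w v≡w)

listEqᵇ-refl : ∀ w → T (listEqᵇ w w)
listEqᵇ-refl []      = _
listEqᵇ-refl (x ∷ w) = Equivalence.from T-∧ (≡⇒≡ᵇ x x refl , listEqᵇ-refl w)

fullMatchᵇ⇒Match : ∀ {j} → length τ ≡ j → ∀ σ i → T (fullMatchᵇ τ σ i) → Match j τ σ i
fullMatchᵇ⇒Match {τ} refl σ i m = listEqᵇ⇒≡ _ τ (proj₂ (Equivalence.to (T-∧ {length (window (length τ) i σ) ≡ᵇ length τ}) m))

Match⇒fullMatchᵇ : ∀ {j} → length τ ≡ j → ∀ σ i → Match j τ σ i → T (fullMatchᵇ τ σ i)
Match⇒fullMatchᵇ {τ} refl σ i m = Equivalence.from T-∧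
  ( ≡⇒≡ᵇ _ (length τ) (trans (sym (length-map _ (window (length τ) i σ))) (cong length m))
  , subst (λ ρ → T (listEqᵇ ρ τ)) (sym m) (listEqᵇ-refl τ))

∈-window : ∀ j i σ → x ∈ window j i σ → x ∈ σ
∈-window j i σ x∈ = subst (_ ∈_) (take++drop≡id i σ)
  (∈-++⁺ʳ (take i σ) (subst (_ ∈_) (take++drop≡id j (drop i σ)) (∈-++⁺ˡ x∈)))

window-window : ∀ j e {k} i σ → e + j ≤ k → window j e (window k i σ) ≡ window j (i + e) σ
window-window j e i σ e+j≤k with r , refl ← m≤n⇒∃[o]m+o≡n e+j≤k = begin
  take j (drop e (take (e + j + r) (drop i σ)))    ≡⟨ cong (λ k → take j (drop e (take k (drop i σ)))) (+-assoc e j r) ⟩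
  take j (drop e (take (e + (j + r)) (drop i σ)))  ≡⟨ cong (take j) (take-drop (j + r) e (drop i σ)) ⟨
  take j (take (j + r) (drop e (drop i σ)))        ≡⟨ take-take j (j + r) _ ⟩
  take (j ⊓ (j + r)) (drop e (drop i σ))           ≡⟨ cong₂ take (m≤n⇒m⊓n≡m (m≤m+n j r)) (drop-drop i e σ) ⟩
  take j (drop (i + e) σ)                          ∎
  where open ≡-Reasoning

red-window-red : ∀ j i w → red (window j i (red w)) ≡ red (window j i w)
red-window-red j i w = trans
  (cong red (trans (cong (take j) (drop-map i w)) (take-map j (drop i w))))
  (red-map (window j i w) λ x∈ y∈ → rank-orderPreserving w (∈-window j i w x∈) (∈-window j i w y∈))

-- Reducing a larger window keeps the relative order inside it. As an equality of types this
-- transports matches between `σ` and the shorter permutation in both directions.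
Match-window : ∀ {j e k} i → e + j ≤ k → Match j τ (red (window k i σ)) e ≡ Match j τ σ (i + e)
Match-window {τ} {σ} {j} {e} {k} i e+j≤k = cong (_≡ τ)
  (trans (red-window-red j e (window k i σ)) (cong red (window-window j e i σ e+j≤k)))

Match-length : ∀ {j} → length τ ≡ j → ∀ σ i → Match j τ σ i → length (window j i σ) ≡ j
Match-length {j = j} refl σ i m = trans (sym (length-map _ (window j i σ))) (cong length m)

-- An empty window fits even beyond the end; positivity of `j` forces `i` inside `σ`, where the
-- truncated difference `length σ ∸ i` is a true one.
length-window-bound : ∀ {j} i σ → 0 < j → length (window j i σ) ≡ j → i + j ≤ length σ
length-window-bound {j} i σ 0<j len = begin
  i + j                    ≤⟨ +-monoʳ-≤ i j≤ ⟩
  i + (length σ ∸ i)       ≡⟨ m+[n∸m]≡n (<⇒≤ i<length) ⟩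
  length σ                 ∎
  where
  open ≤-Reasoning
  j≤ : j ≤ length σ ∸ i
  j≤ = subst (j ≤_) (length-drop i σ) (m⊓n≡m⇒m≤n (trans (sym (length-take j (drop i σ))) len))
  i<length : i < length σ
  i<length = m∸n≢0⇒n<m λ eq → <⇒≱ 0<j (subst (j ≤_) eq j≤)

mch-positive : ∀ {j i} → length τ ≡ j → i < length σ → Match j τ σ i → 1 ≤ τ -mch σ
mch-positive {τ} {σ} {i = i} len i< m =
  ∈-length (∈-filter⁺ (T? ∘ fullMatchᵇ τ σ) (∈-upTo⁺ i<) (Match⇒fullMatchᵇ len σ i m))

module _ {j} (0<j : 0 < j) where

  -- Windows of length `j` at distance `d` span `j + d` positions; `suc d < j` says that they share
  -- at least two entries.
  overlap-bound : ∀ {d} → suc d < j → j + d < 2 * j ∸ 1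
  overlap-bound {d} d< = pred-mono-≤ (begin
    suc (suc (j + d))  ≡⟨ cong suc (+-suc j d) ⟨
    suc (j + suc d)    ≡⟨ +-suc j (suc d) ⟨
    j + suc (suc d)    ≤⟨ +-monoʳ-≤ j d< ⟩
    j + j              ≡⟨ cong (j +_) (+-identityʳ j) ⟨
    2 * j              ∎)
    where open ≤-Reasoning

  module _ (τ τ′ : List ℕ) (lenτ : length τ ≡ j) (lenτ′ : length τ′ ≡ j)
    {σ} (u : Unique σ) (i : ℕ) {d} (m : Match j τ σ i) (m′ : Match j τ′ σ (i + d)) where

    -- A permutation of length `j + d` that begins with the first match and ends with the second;
    -- the minimality hypotheses are applied to it.
    spanned : List ℕ
    spanned = red (window (j + d) i σ)

    private
      i+j+d≤ : i + (j + d) ≤ length σ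
      i+j+d≤ = subst (_≤ length σ) (trans (+-assoc i d j) (cong (i +_) (+-comm d j)))
        (length-window-bound (i + d) σ 0<j (Match-length lenτ′ σ (i + d) m′))

      length-W : length (window (j + d) i σ) ≡ j + d
      length-W = trans (length-take (j + d) (drop i σ)) (m≤n⇒m⊓n≡m
        (subst (j + d ≤_) (sym (length-drop i σ)) (m+n≤o⇒m≤o∸n (j + d) (subst (_≤ length σ) (+-comm i (j + d)) i+j+d≤))))

    length-spanned : length spanned ≡ j + d
    length-spanned = trans (length-map _ (window (j + d) i σ)) length-W

    spanned-∈S : spanned ∈ S (j + d)
    spanned-∈S = subst (λ k → spanned ∈ S k) length-W (red-∈S (Unique.take⁺ (j + d) (Unique.drop⁺ i u)))

    spanned-Match : ∀ {ρ e} → e ≤ d → Match j ρ spanned e ≡ Match j ρ σ (i + e)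
    spanned-Match {e = e} e≤d = Match-window {σ = σ} i (subst (e + j ≤_) (+-comm d j) (+-monoˡ-≤ j e≤d))

    spanned-first : Match j τ spanned 0
    spanned-first = subst id (sym (spanned-Match z≤n)) (subst (Match j τ σ) (sym (+-identityʳ i)) m)

    spanned-last : Match j τ′ spanned d
    spanned-last = subst id (sym (spanned-Match ≤-refl)) m′

    first<length : 0 < length spanned
    first<length = subst (0 <_) (sym length-spanned) (<-≤-trans 0<j (m≤m+n j d))

    last<length : d < length spanned
    last<length = subst (d <_) (sym length-spanned) (m<n+m d 0<j)

  -- Two matches at minimal distance are the only ones in the window they span, which therefore
  -- has exactly two matches, as MinimalOverlapping asks for.
  minimalOverlapping⇒apart : MinimalOverlapping j τ → length τ ≡ j → Unique σ →
    ∀ i {d} → 0 < d → suc d < j → Match j τ σ i → ¬ Match j τ σ (i + d)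
  minimalOverlapping⇒apart {τ} {σ} (_ , minimal) lenτ u i {d} = <-rec P step d i
    where
    P : ℕ → Set
    P d = ∀ i → 0 < d → suc d < j → Match j τ σ i → ¬ Match j τ σ (i + d)

    step : ∀ d → (∀ {e} → e < d → P e) → P d
    step d rec i 0<d d< m m′ = minimal (j + d) (overlap-bound d<) O (spanned-∈S τ τ lenτ lenτ u i m m′)
      (↭-length (unique∧set⇒↭ (Unique.filter⁺ P? (Unique.upTo⁺ (length O))) ((<⇒≢ 0<d ∷ []) ∷ [] ∷ []) sound complete))
      where
      O = spanned τ τ lenτ lenτ u i m m′
      P? = T? ∘ fullMatchᵇ τ O

      len : length O ≡ j + d
      len = length-spanned τ τ lenτ lenτ u i m m′

      sound : ∀ {e} → e ∈ filterᵇ (fullMatchᵇ τ O) (upTo (length O)) → e ∈ 0 ∷ d ∷ []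
      sound {e} e∈ = only e refl
        where
        me : Match j τ O e
        me = fullMatchᵇ⇒Match lenτ O e (proj₂ (∈-filter⁻ P? {xs = upTo (length O)} e∈))

        e≤d : e ≤ d
        e≤d = +-cancelʳ-≤ j e d (subst (e + j ≤_) (trans len (+-comm j d))
          (length-window-bound e O 0<j (Match-length lenτ O e me)))

        only : ∀ e′ → e ≡ e′ → e ∈ 0 ∷ d ∷ []
        only zero    refl = here refl
        only (suc _) refl with m≤n⇒m<n∨m≡n e≤d
        ... | inj₂ e≡d = there (here e≡d)
        -- A match strictly in between would lie at the smaller distance `e` from the match at `i`,
        -- which the induction excludes.
        ... | inj₁ e<d = ⊥-elim (rec e<d i (s≤s z≤n) (<-trans (s≤s e<d) d<) m
          (subst id (spanned-Match τ τ lenτ lenτ u i m m′ e≤d) me))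

      complete : ∀ {e} → e ∈ 0 ∷ d ∷ [] → e ∈ filterᵇ (fullMatchᵇ τ O) (upTo (length O))
      complete (here refl) = ∈-filter⁺ P? (∈-upTo⁺ (first<length τ τ lenτ lenτ u i m m′))
        (Match⇒fullMatchᵇ lenτ O 0 (spanned-first τ τ lenτ lenτ u i m m′))
      complete (there (here refl)) = ∈-filter⁺ P? (∈-upTo⁺ (last<length τ τ lenτ lenτ u i m m′))
        (Match⇒fullMatchᵇ lenτ O d (spanned-last τ τ lenτ lenτ u i m m′))

-- The hypothesis asks for at least one match of each pattern, so further matches in the spanned
-- stretch do no harm and no induction is required. Distance 0 is included.
mutuallyMinimalOverlapping⇒apart : ∀ {j} → 0 < j → ∀ {τ τ′} → length τ ≡ j → length τ′ ≡ j →
  (∀ n → n < 2 * j ∸ 1 → ∀ σ → σ ∈ S n → 1 ≤ τ -mch σ → 1 ≤ τ′ -mch σ → ⊥) →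
  Unique σ → ∀ i {d} → suc d < j → Match j τ σ i → ¬ Match j τ′ σ (i + d)
mutuallyMinimalOverlapping⇒apart {j = j} 0<j {τ} {τ′} len len′ minimal u i {d} d< m m′ =
  minimal (j + d) (overlap-bound 0<j d<) _ (spanned-∈S 0<j τ τ′ len len′ u i m m′)
    (mch-positive len (first<length 0<j τ τ′ len len′ u i m m′) (spanned-first 0<j τ τ′ len len′ u i m m′))
    (mch-positive len′ (last<length 0<j τ τ′ len len′ u i m m′) (spanned-last 0<j τ τ′ len len′ u i m m′))

mch-positive⁻ : ∀ {j} → length τ ≡ j → 1 ≤ τ -mch σ → ∃[ i ] Match j τ σ i
mch-positive⁻ {τ} {σ} len 1≤ with filterᵇ (fullMatchᵇ τ σ) (upTo (length σ)) in eq
... | i ∷ _ = i , fullMatchᵇ⇒Match len σ i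
  (proj₂ (∈-filter⁻ (T? ∘ fullMatchᵇ τ σ) {xs = upTo (length σ)} (subst (i ∈_) (sym eq) (here refl))))

-- Exchanging two arrangements of a window

take-length-++ : ∀ (u {v} : List ℕ) → take (length u) (u ++ v) ≡ u
take-length-++ []      = refl
take-length-++ (x ∷ u) = cong (x ∷_) (take-length-++ u)

drop-length-++ : ∀ (u {v} : List ℕ) → drop (length u) (u ++ v) ≡ v
drop-length-++ []      = refl
drop-length-++ (x ∷ u) = drop-length-++ u

drop-++-≥ : ∀ (u u′ : List ℕ) {v} i → length u ≡ length u′ → length u ≤ i → drop i (u ++ v) ≡ drop i (u′ ++ v)
drop-++-≥ []      []       i       _   _  = refl
drop-++-≥ (_ ∷ u) (_ ∷ u′) (suc i) len le = drop-++-≥ u u′ i (suc-injective len) (s≤s⁻¹ le)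

take-++-≤ : ∀ (u {v v′} : List ℕ) i → i ≤ length u → take i (u ++ v) ≡ take i (u ++ v′)
take-++-≤ u       zero    _  = refl
take-++-≤ (x ∷ u) (suc i) le = cong (x ∷_) (take-++-≤ u i (s≤s⁻¹ le))

window-++-≤ : ∀ (u {v v′} : List ℕ) j i → i + j ≤ length u → window j i (u ++ v) ≡ window j i (u ++ v′)
window-++-≤ u {v} {v′} j i le = trans (take-drop j i (u ++ v))
  (trans (cong (drop i) (take-++-≤ u (i + j) le)) (sym (take-drop j i (u ++ v′))))

-- A window before and after an exchange. The first entries agree as well: they are the head of `p`,
-- or `c` if `p` is empty.
record Twin (w w′ : List ℕ) : Set where
  field
    p M M′ : List ℕ
    c z    : ℕ
    w≡     : w ≡ p ++ c ∷ M ++ z ∷ []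
    w′≡    : w′ ≡ p ++ c ∷ M′ ++ z ∷ []
    perm   : w ↭ w′
    min    : All (c ≤_) w
    des≡   : des w ≡ des w′

regroup : ∀ (u p : List ℕ) c M z v → u ++ (p ++ c ∷ M ++ z ∷ []) ++ v ≡ (u ++ p) ++ c ∷ M ++ z ∷ v
regroup u p c M z v = begin
  u ++ (p ++ c ∷ M ++ z ∷ []) ++ v    ≡⟨ cong (u ++_) (++-assoc p (c ∷ M ++ z ∷ []) v) ⟩
  u ++ p ++ c ∷ (M ++ z ∷ []) ++ v    ≡⟨ cong (λ r → u ++ p ++ c ∷ r) (++-assoc M (z ∷ []) v) ⟩
  u ++ p ++ c ∷ M ++ z ∷ v            ≡⟨ ++-assoc u p (c ∷ M ++ z ∷ v) ⟨
  (u ++ p) ++ c ∷ M ++ z ∷ v          ∎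
  where open ≡-Reasoning

des-segments : ∀ p c M z v →
  des (p ++ c ∷ M ++ z ∷ v) ≡ des (p ++ c ∷ []) + (des (c ∷ M ++ z ∷ []) + des (z ∷ v))
des-segments p c M z v = trans (des-++ p c (M ++ z ∷ v)) (cong (des (p ++ c ∷ []) +_) (des-++ (c ∷ M) z v))

module _ {w w′ : List ℕ} (t : Twin w w′) where
  open Twin t

  private
    -- The descents up to `c` are common and cancel in `des≡`; with nothing after `z` the last
    -- segment contributes the 0.
    des-core : des (c ∷ M ++ z ∷ []) ≡ des (c ∷ M′ ++ z ∷ [])
    des-core = +-cancelʳ-≡ 0 _ _ (+-cancelˡ-≡ (des (p ++ c ∷ [])) _ _ (begin
      des (p ++ c ∷ []) + (des (c ∷ M ++ z ∷ []) + 0)    ≡⟨ des-segments p c M z [] ⟨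
      des (p ++ c ∷ M ++ z ∷ [])                         ≡⟨ cong des w≡ ⟨
      des w                                              ≡⟨ des≡ ⟩
      des w′                                             ≡⟨ cong des w′≡ ⟩
      des (p ++ c ∷ M′ ++ z ∷ [])                        ≡⟨ des-segments p c M′ z [] ⟩
      des (p ++ c ∷ []) + (des (c ∷ M′ ++ z ∷ []) + 0)   ∎))
      where open ≡-Reasoning

  des-twin : ∀ u v → des (u ++ w ++ v) ≡ des (u ++ w′ ++ v)
  des-twin u v rewrite w≡ | w′≡ | regroup u p c M z v | regroup u p c M′ z v = begin
    des ((u ++ p) ++ c ∷ M ++ z ∷ v)                                          ≡⟨ des-segments (u ++ p) c M z v ⟩
    des ((u ++ p) ++ c ∷ []) + (des (c ∷ M ++ z ∷ []) + des (z ∷ v))    ≡⟨ cong (λ d → des ((u ++ p) ++ c ∷ []) + (d + des (z ∷ v))) des-core ⟩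
    des ((u ++ p) ++ c ∷ []) + (des (c ∷ M′ ++ z ∷ []) + des (z ∷ v))   ≡⟨ des-segments (u ++ p) c M′ z v ⟨
    des ((u ++ p) ++ c ∷ M′ ++ z ∷ v)                                         ∎
    where open ≡-Reasoning

  -- c is the minimum of both windows, so neither has a left-to-right minimum after it.
  lrminAux-twin : ∀ pre → lrminAux pre w ≡ lrminAux pre w′
  lrminAux-twin pre = trans (upTo-c w≡ min) (sym (upTo-c w′≡ (All-resp-↭ perm min)))
    where
    upTo-c : ∀ {v N} → v ≡ p ++ c ∷ N ++ z ∷ [] → All (c ≤_) v → lrminAux pre v ≡ lrminAux pre (p ++ c ∷ [])
    upTo-c {N = N} refl c≤ = begin
      lrminAux pre (p ++ c ∷ R)                                               ≡⟨ cong (lrminAux pre) (++-assoc p (c ∷ []) R) ⟨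
      lrminAux pre ((p ++ c ∷ []) ++ R)                                       ≡⟨ lrminAux-++ pre (p ++ c ∷ []) R ⟩
      lrminAux pre (p ++ c ∷ []) + lrminAux ((p ++ c ∷ []) ++ pre) R          ≡⟨ cong (lrminAux pre (p ++ c ∷ []) +_)
                                                                                   (lrminAux-≥ (∈-++⁺ˡ (∈-++⁺ʳ p (here refl))) (All.tail (++⁻ʳ p c≤))) ⟩
      lrminAux pre (p ++ c ∷ []) + 0                                          ≡⟨ +-identityʳ _ ⟩
      lrminAux pre (p ++ c ∷ [])                                              ∎
      where
      open ≡-Reasoning
      R = N ++ z ∷ []

  LRmin-twin : ∀ u v → LRmin (u ++ w ++ v) ≡ LRmin (u ++ w′ ++ v)
  LRmin-twin u v = trans (split w) (trans
    -- Entries after the window are compared with the same earlier values, in another order.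
    (cong (LRmin u +_) (cong₂ _+_ (lrminAux-twin (u ++ [])) (lrminAux-↭ (++⁺ʳ (u ++ []) perm) v)))
    (sym (split w′)))
    where
    split : ∀ x → LRmin (u ++ x ++ v) ≡ LRmin u + (lrminAux (u ++ []) x + lrminAux (x ++ u ++ []) v)
    split x = trans (lrminAux-++ [] u (x ++ v)) (cong (LRmin u +_) (lrminAux-++ (u ++ []) x v))

  inv-twin : inv w ≡ inv w′ → ∀ u v → inv (u ++ w ++ v) ≡ inv (u ++ w′ ++ v)
  inv-twin eq u v = inv-++-congˡ u (++⁺ʳ v perm) (inv-++-congʳ v perm eq)

  -- Twins agree in their first and last entries, so windows meeting them in one entry only do not see the difference.
  module _ (u v : List ℕ) {j i : ℕ} where

    window-twin-left : i + j ≤ suc (length u) → window j i (u ++ w ++ v) ≡ window j i (u ++ w′ ++ v)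
    window-twin-left le = begin
      window j i (u ++ w ++ v)                                  ≡⟨ cong (window j i) (shape w≡) ⟩
      window j i ((u ++ p ++ c ∷ []) ++ M ++ z ∷ v)             ≡⟨ window-++-≤ (u ++ p ++ c ∷ []) j i (≤-trans le u<) ⟩
      window j i ((u ++ p ++ c ∷ []) ++ M′ ++ z ∷ v)            ≡⟨ cong (window j i) (shape w′≡) ⟨
      window j i (u ++ w′ ++ v)                                 ∎
      where
      open ≡-Reasoning
      shape : ∀ {x N} → x ≡ p ++ c ∷ N ++ z ∷ [] → u ++ x ++ v ≡ (u ++ p ++ c ∷ []) ++ N ++ z ∷ v
      shape {N = N} refl = trans (regroup u p c N z v)
        (trans (sym (++-assoc (u ++ p) (c ∷ []) _)) (cong (_++ N ++ z ∷ v) (++-assoc u p (c ∷ []))))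
      -- The agreeing part ends in `c`, so it exceeds `u` by an entry even when `p` is empty; this
      -- is the one entry that the other window may share.
      u< : suc (length u) ≤ length (u ++ p ++ c ∷ [])
      u< = ≤-trans (s≤s (length-++-≤ˡ u)) (≤-reflexive (sym (trans (cong length (sym (++-assoc u p (c ∷ []))))
             (trans (length-++ (u ++ p)) (+-comm _ 1)))))

    window-twin-right : length u + length w ≤ suc i → window j i (u ++ w ++ v) ≡ window j i (u ++ w′ ++ v)
    window-twin-right le = cong (take j) (begin
      drop i (u ++ w ++ v)                         ≡⟨ cong (drop i) (shape w≡) ⟩
      drop i (((u ++ p) ++ c ∷ M) ++ z ∷ v)        ≡⟨ drop-++-≥ ((u ++ p) ++ c ∷ M) ((u ++ p) ++ c ∷ M′) i
                                                        (suc-injective (trans (len w≡) (trans (cong (length u +_) (↭-length perm)) (sym (len w′≡)))))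
                                                        (s≤s⁻¹ (subst (_≤ suc i) (sym (len w≡)) le)) ⟩
      drop i (((u ++ p) ++ c ∷ M′) ++ z ∷ v)       ≡⟨ cong (drop i) (shape w′≡) ⟨
      drop i (u ++ w′ ++ v)                        ∎)
      where
      open ≡-Reasoning
      shape : ∀ {x N} → x ≡ p ++ c ∷ N ++ z ∷ [] → u ++ x ++ v ≡ ((u ++ p) ++ c ∷ N) ++ z ∷ v
      shape {N = N} refl = trans (regroup u p c N z v) (sym (++-assoc (u ++ p) (c ∷ N) (z ∷ v)))
      -- The `suc` stands for `z`, the common last entry, with which a window on the right may
      -- begin.
      len : ∀ {x N} → x ≡ p ++ c ∷ N ++ z ∷ [] → suc (length ((u ++ p) ++ c ∷ N)) ≡ length u + length x
      len {N = N} refl = begin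
        suc (length ((u ++ p) ++ c ∷ N))           ≡⟨ +-comm _ 1 ⟨
        length ((u ++ p) ++ c ∷ N) + 1             ≡⟨ length-++ ((u ++ p) ++ c ∷ N) ⟨
        length (((u ++ p) ++ c ∷ N) ++ z ∷ [])     ≡⟨ cong length (++-assoc (u ++ p) (c ∷ N) (z ∷ [])) ⟩
        length ((u ++ p) ++ c ∷ N ++ z ∷ [])       ≡⟨ cong length (++-assoc u p (c ∷ N ++ z ∷ [])) ⟩
        length (u ++ p ++ c ∷ N ++ z ∷ [])         ≡⟨ length-++ u ⟩
        length u + length (p ++ c ∷ N ++ z ∷ [])   ∎

-- The exchange at one position and the mixed counts

module Patterns (pre m m′ : List ℕ) (z : ℕ) where

  α β : List ℕ
  α = pre ++ 1 ∷ m ++ z ∷ []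
  β = pre ++ 1 ∷ m′ ++ z ∷ []

  j : ℕ
  j = length α

  module Exchange
    (α↭β : α ↭ β) (des≡ : des α ≡ des β) (α≢β : α ≢ β)
    (apart : ∀ {τ τ′ σ} → τ ∈ α ∷ β ∷ [] → τ′ ∈ α ∷ β ∷ [] → Unique σ →
             ∀ i {d} → 0 < d → suc d < j → Match j τ σ i → ¬ Match j τ′ σ (i + d))
    where

    lenβ : length β ≡ j
    lenβ = sym (↭-length α↭β)

    0<j : 0 < j
    0<j = ∈-length (∈-insert pre)

    -- Having the same entries, both windows are images of their patterns under the same map
    -- `select v`, so the common parts of α and β become common parts of the windows.
    red-twin : red v ≡ α → red w ≡ β → v ↭ w → Twin v w
    red-twin {v} {w} v-α w-β π = record
      { p    = map (select v) pre
      ; M    = map (select v) m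
      ; M′   = map (select v) m′
      ; c    = select v 1
      ; z    = select v z
      ; w≡   = shape v-α ↭-refl
      ; w′≡  = shape w-β π
      ; perm = π
      -- An entry below `c` would have a rank below 1, but ranks start at 1.
      ; min  = All.tabulate λ {y} y∈ → ≮⇒≥ λ y<c →
          <⇒≱ (subst (rank v y <_) rank-c (rank-mono-< y∈ y<c)) (s≤s z≤n)
      ; des≡ = trans (sym (des-red v)) (trans (cong des v-α) (trans des≡ (trans (cong des (sym w-β)) (des-red w))))
      }
      where
      shape : ∀ {x N} → red x ≡ pre ++ 1 ∷ N ++ z ∷ [] → v ↭ x →
        x ≡ map (select v) pre ++ select v 1 ∷ map (select v) N ++ select v z ∷ []
      shape {x} {N} eq π = begin
        x                                                   ≡⟨ arrange-red π ⟨
        map (select v) (red x)                              ≡⟨ cong (map (select v)) eq ⟩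
        map (select v) (pre ++ 1 ∷ N ++ z ∷ [])             ≡⟨ map-++ (select v) pre _ ⟩
        map (select v) pre ++ select v 1 ∷ map (select v) (N ++ z ∷ [])
          ≡⟨ cong (λ r → map (select v) pre ++ select v 1 ∷ r) (map-++ (select v) N _) ⟩
        map (select v) pre ++ select v 1 ∷ map (select v) N ++ select v z ∷ []   ∎
        where open ≡-Reasoning

      rank-c : rank v (select v 1) ≡ 1
      rank-c = rank-select {w = v} (subst (1 ∈_) (sym v-α) (∈-insert pre))

    θ : List ℕ → List ℕ
    θ τ with ≡-dec _≟_ τ α | ≡-dec _≟_ τ β
    ... | yes _ | _     = β
    ... | no  _ | yes _ = α
    ... | no  _ | no  _ = τ

    θ-α : θ α ≡ β
    θ-α with ≡-dec _≟_ α α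
    ... | yes _   = refl
    ... | no  α≢α = contradiction refl α≢α

    θ-β : θ β ≡ α
    θ-β with ≡-dec _≟_ β α | ≡-dec _≟_ β β
    ... | yes β≡α | _       = β≡α
    ... | no  _   | yes _   = refl
    ... | no  _   | no  β≢β = contradiction refl β≢β

    θ-other : ∀ {τ} → τ ≢ α → τ ≢ β → θ τ ≡ τ
    θ-other {τ} τ≢α τ≢β with ≡-dec _≟_ τ α | ≡-dec _≟_ τ β
    ... | yes τ≡α | _       = contradiction τ≡α τ≢α
    ... | no  _   | yes τ≡β = contradiction τ≡β τ≢β
    ... | no  _   | no  _   = refl

    θ-↭ : ∀ τ → θ τ ↭ τ
    θ-↭ τ with ≡-dec _≟_ τ α | ≡-dec _≟_ τ β
    ... | yes refl | _        = ↭-sym α↭β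
    ... | no  _    | yes refl = α↭β
    ... | no  _    | no  _    = ↭-refl

    exchange : List ℕ → List ℕ
    exchange w = arrange (θ (red w)) w

    swapAt : ℕ → List ℕ → List ℕ
    swapAt k σ = take k σ ++ exchange (window j k σ) ++ drop j (drop k σ)

    split-window : ∀ k σ → take k σ ++ window j k σ ++ drop j (drop k σ) ≡ σ
    split-window k σ = trans (cong (take k σ ++_) (take++drop≡id j (drop k σ))) (take++drop≡id k σ)

    swapAt-↭ : ∀ k σ → swapAt k σ ↭ σ
    swapAt-↭ k σ = ↭-trans
      (++⁺ˡ (take k σ) (++⁺ʳ (drop j (drop k σ)) (arrange-↭ {w = window j k σ} (θ-↭ (red (window j k σ))))))
      (↭-reflexive (split-window k σ))

    -- Oriented, with α on the side of `σ` and β on that of `σ′`, so each invariance is proved once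
    -- and serves both directions of the exchange.
    record Exchanged (k : ℕ) (σ σ′ : List ℕ) : Set where
      field
        before old new after : List ℕ
        σ≡       : σ ≡ before ++ old ++ after
        σ′≡      : σ′ ≡ before ++ new ++ after
        length-before : length before ≡ k
        red-old    : red old ≡ α
        red-new   : red new ≡ β
        perm     : old ↭ new

      twin : Twin old new
      twin = red-twin red-old red-new perm

      length-old : length old ≡ j
      length-old = trans (sym (length-map _ old)) (cong length red-old)

      private
        window-mid : ∀ x → length x ≡ j → window j k (before ++ x ++ after) ≡ x
        window-mid x len = trans (cong (take j) (trans (cong (λ k → drop k (before ++ x ++ after)) (sym length-before)) (drop-length-++ before)))
          (trans (cong (λ j → take j (x ++ after)) (sym len)) (take-length-++ x))

        swapAt-mid : ∀ x → length x ≡ j → swapAt k (before ++ x ++ after) ≡ before ++ exchange x ++ after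
        swapAt-mid x len rewrite window-mid x len = cong₂ (λ a b → a ++ exchange x ++ b)
          (trans (cong (λ k → take k (before ++ x ++ after)) (sym length-before)) (take-length-++ before))
          (trans (cong₂ drop (sym len) (trans (cong (λ k → drop k (before ++ x ++ after)) (sym length-before)) (drop-length-++ before))) (drop-length-++ x))

        length-new : length new ≡ j
        length-new = trans (sym (↭-length perm)) length-old

      swapAt-σ : swapAt k σ ≡ σ′
      swapAt-σ rewrite σ≡ | σ′≡ = trans (swapAt-mid old length-old) (cong (λ x → before ++ x ++ after)
        (trans (cong (λ τ → arrange τ old) (trans (cong θ red-old) (trans θ-α (sym red-new)))) (arrange-red perm)))

      swapAt-σ′ : swapAt k σ′ ≡ σ
      swapAt-σ′ rewrite σ≡ | σ′≡ = trans (swapAt-mid new length-new) (cong (λ x → before ++ x ++ after)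
        (trans (cong (λ τ → arrange τ new) (trans (cong θ red-new) (trans θ-β (sym red-old)))) (arrange-red (↭-sym perm))))

      match-σ : Match j α σ k
      match-σ = trans (cong red (trans (cong (window j k) σ≡) (window-mid old length-old))) red-old

      match-σ′ : Match j β σ′ k
      match-σ′ = trans (cong red (trans (cong (window j k) σ′≡) (window-mid new length-new))) red-new

    length-take-match : ∀ {τ k} → length τ ≡ j → ∀ σ → Match j τ σ k → length (take k σ) ≡ k
    length-take-match {k = k} len σ m = trans (length-take k σ)
      (m≤n⇒m⊓n≡m (m+n≤o⇒m≤o k (length-window-bound k σ 0<j (Match-length len σ k m))))

    data View (k : ℕ) (σ : List ℕ) : Set where
      fixed    : swapAt k σ ≡ σ → ¬ Match j α σ k → ¬ Match j β σ k → View k σ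
      forward  : Exchanged k σ (swapAt k σ) → View k σ
      backward : Exchanged k (swapAt k σ) σ → View k σ

    view : ∀ k σ → View k σ
    view k σ with ≡-dec _≟_ (red (window j k σ)) α | ≡-dec _≟_ (red (window j k σ)) β
    ... | yes m | _ = forward record
      { before = take k σ ; old = window j k σ ; new = exchange (window j k σ) ; after = drop j (drop k σ)
      ; σ≡ = sym (split-window k σ) ; σ′≡ = refl
      ; length-before = length-take-match refl σ m
      ; red-old = m ; red-new = trans (red-arrange {w = window j k σ} (θ-↭ _)) (trans (cong θ m) θ-α)
      ; perm = ↭-sym (arrange-↭ {w = window j k σ} (θ-↭ _)) }
    ... | no _ | yes m = backward record
      { before = take k σ ; old = exchange (window j k σ) ; new = window j k σ ; after = drop j (drop k σ)
      ; σ≡ = refl ; σ′≡ = sym (split-window k σ)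
      ; length-before = length-take-match lenβ σ m
      ; red-old = trans (red-arrange {w = window j k σ} (θ-↭ _)) (trans (cong θ m) θ-β) ; red-new = m
      ; perm = arrange-↭ {w = window j k σ} (θ-↭ _) }
    ... | no ¬α | no ¬β = fixed
      (trans (cong (λ x → take k σ ++ x ++ drop j (drop k σ))
        (trans (cong (λ τ → arrange τ (window j k σ)) (θ-other ¬α ¬β)) (arrange-red ↭-refl))) (split-window k σ)) ¬α ¬β

    swapAt-involutive : ∀ k σ → swapAt k (swapAt k σ) ≡ σ
    swapAt-involutive k σ with view k σ
    ... | fixed eq _ _ = trans (cong (swapAt k) eq) eq
    ... | forward e    = Exchanged.swapAt-σ′ e
    ... | backward e   = Exchanged.swapAt-σ e

    swapAt-invariant : (f : List ℕ → A) → (∀ {k σ σ′} → Exchanged k σ σ′ → f σ ≡ f σ′) →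
      ∀ k σ → f (swapAt k σ) ≡ f σ
    swapAt-invariant f inv k σ with view k σ
    ... | fixed eq _ _ = cong f eq
    ... | forward e    = sym (inv e)
    ... | backward e   = inv e

    -- The two strict bounds say that the windows at `i` and `k` share at least two entries,
    -- whichever comes first.
    apart′ : ∀ {τ τ′ σ} → τ ∈ α ∷ β ∷ [] → τ′ ∈ α ∷ β ∷ [] → Unique σ →
      ∀ {i k} → i ≢ k → suc i < k + j → suc k < i + j → Match j τ σ k → ¬ Match j τ′ σ i
    apart′ {τ} {τ′} {σ} τ∈ τ′∈ u {i} {k} i≢k i< k< mk mi with <-cmp i k
    ... | tri≈ _ i≡k _ = i≢k i≡k
    ... | tri< i<k _ _ = apart τ′∈ τ∈ u i (m<n⇒0<n∸m i<k)
      (+-cancelˡ-< i _ _ (subst (_< i + j) (trans (cong suc (sym (m+[n∸m]≡n (<⇒≤ i<k)))) (sym (+-suc i _))) k<))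
      mi (subst (Match j τ σ) (sym (m+[n∸m]≡n (<⇒≤ i<k))) mk)
    ... | tri> _ _ k<i = apart τ∈ τ′∈ u k (m<n⇒0<n∸m k<i)
      (+-cancelˡ-< k _ _ (subst (_< k + j) (trans (cong suc (sym (m+[n∸m]≡n (<⇒≤ k<i)))) (sym (+-suc k _))) i<))
      mk (subst (Match j τ′ σ) (sym (m+[n∸m]≡n (<⇒≤ k<i))) mi)

    -- If the windows share two entries, the match at `k`, present in both `σ` and `σ′`, forbids any
    -- match at `i` and both implications are vacuous. Otherwise the window at `i` is literally the
    -- same list in both.
    Exchanged-Match : ∀ {τ i k σ σ′} → τ ∈ α ∷ β ∷ [] → i ≢ k → Unique σ → Unique σ′ → Exchanged k σ σ′ →
      (Match j τ σ i → Match j τ σ′ i) × (Match j τ σ′ i → Match j τ σ i)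
    Exchanged-Match {τ} {i} {k} {σ} {σ′} τ∈ i≢k uσ uσ′ e with suc i <? k + j | suc k <? i + j
    ... | yes i< | yes k< = (λ mi → ⊥-elim (apart′ (here refl) τ∈ uσ i≢k i< k< match-σ mi))
                          , (λ mi → ⊥-elim (apart′ (there (here refl)) τ∈ uσ′ i≢k i< k< match-σ′ mi))
      where open Exchanged e
    ... | no i≮ | _ = trans (cong red (sym eq)) , trans (cong red eq)
      where
      open Exchanged e
      eq : window j i σ ≡ window j i σ′
      eq rewrite σ≡ | σ′≡ = window-twin-right twin before after
        (subst (_≤ suc i) (sym (cong₂ _+_ length-before length-old)) (≮⇒≥ i≮))
    ... | yes _ | no k≮ = trans (cong red (sym eq)) , trans (cong red eq)
      where
      open Exchanged e
      eq : window j i σ ≡ window j i σ′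
      eq rewrite σ≡ | σ′≡ = window-twin-left twin before after (subst (λ k → i + j ≤ suc k) (sym length-before) (≮⇒≥ k≮))

    pattern-length : ∀ {τ} → τ ∈ α ∷ β ∷ [] → length τ ≡ j
    pattern-length (here refl)         = refl
    pattern-length (there (here refl)) = lenβ

    fullMatchᵇ-cong : ∀ {τ τ′} σ σ′ i → τ ∈ α ∷ β ∷ [] → τ′ ∈ α ∷ β ∷ [] →
      (Match j τ σ i → Match j τ′ σ′ i) × (Match j τ′ σ′ i → Match j τ σ i) →
      fullMatchᵇ τ σ i ≡ fullMatchᵇ τ′ σ′ i
    fullMatchᵇ-cong σ σ′ i τ∈ τ′∈ (f , g) = ⇔⇒≡
      (Match⇒fullMatchᵇ (pattern-length τ′∈) σ′ i ∘ f ∘ fullMatchᵇ⇒Match (pattern-length τ∈) σ i)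
      (Match⇒fullMatchᵇ (pattern-length τ∈) σ i ∘ g ∘ fullMatchᵇ⇒Match (pattern-length τ′∈) σ′ i)

    swapAt-Unique : ∀ k {σ} → Unique σ → Unique (swapAt k σ)
    swapAt-Unique k {σ} = Unique-resp-↭ (↭⇒↭ₛ (↭-sym (swapAt-↭ k σ)))

    fullMatchᵇ-swapAt-≢ : ∀ {τ i} k σ → τ ∈ α ∷ β ∷ [] → i ≢ k → Unique σ →
      fullMatchᵇ τ (swapAt k σ) i ≡ fullMatchᵇ τ σ i
    fullMatchᵇ-swapAt-≢ {τ} {i} k σ τ∈ i≢k u with view k σ
    ... | fixed eq _ _ = cong (λ σ → fullMatchᵇ τ σ i) eq
    ... | forward e    = sym (fullMatchᵇ-cong σ (swapAt k σ) i τ∈ τ∈ (Exchanged-Match τ∈ i≢k u (swapAt-Unique k u) e))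
    ... | backward e   = fullMatchᵇ-cong (swapAt k σ) σ i τ∈ τ∈ (Exchanged-Match τ∈ i≢k (swapAt-Unique k u) u e)

    fullMatchᵇ-swapAt : ∀ k σ → fullMatchᵇ α (swapAt k σ) k ≡ fullMatchᵇ β σ k
    fullMatchᵇ-swapAt k σ = fullMatchᵇ-cong (swapAt k σ) σ k (here refl) (there (here refl)) (by (view k σ))
      where
      by : View k σ → (Match j α (swapAt k σ) k → Match j β σ k) × (Match j β σ k → Match j α (swapAt k σ) k)
      by (fixed eq ¬α ¬β) = (λ mα → contradiction (subst (λ σ → Match j α σ k) eq mα) ¬α) , (λ mβ → contradiction mβ ¬β)
      -- Both sides are false here: the window holds β after the exchange and α before it, and the
      -- patterns differ.
      by (forward e)      = (λ mα → contradiction (trans (sym mα) (Exchanged.match-σ′ e)) α≢β)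
                          , (λ mβ → contradiction (trans (sym (Exchanged.match-σ e)) mβ) α≢β)
      by (backward e)     = (λ _ → Exchanged.match-σ′ e) , (λ _ → Exchanged.match-σ e)

    -- The pattern looked for at position i after the first k positions have been swapped.
    patternAt : ℕ → ℕ → List ℕ
    patternAt k i = if i <ᵇ k then β else α

    patternAt-< : ∀ {k i} → i < k → patternAt k i ≡ β
    patternAt-< i<k rewrite T⇒≡true (<⇒<ᵇ i<k) = refl

    patternAt-≥ : ∀ {k i} → k ≤ i → patternAt k i ≡ α
    patternAt-≥ {k} {i} k≤i with i <ᵇ k in eq
    ... | true  = contradiction (<ᵇ⇒< i k (Equivalence.from T-≡ eq)) (≤⇒≯ k≤i)
    ... | false = refl

    fullMatchᵇ-patternAt : ∀ k σ i → Unique σ →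
      fullMatchᵇ (patternAt k i) (swapAt k σ) i ≡ fullMatchᵇ (patternAt (suc k) i) σ i
    fullMatchᵇ-patternAt k σ i u with <-cmp i k
    ... | tri< i<k i≢k _ rewrite patternAt-< i<k | patternAt-< (m<n⇒m<1+n i<k) =
      fullMatchᵇ-swapAt-≢ k σ (there (here refl)) i≢k u
    ... | tri≈ _ refl _ rewrite patternAt-≥ (≤-refl {k}) | patternAt-< (n<1+n k) = fullMatchᵇ-swapAt k σ
    ... | tri> _ i≢k k<i rewrite patternAt-≥ (<⇒≤ k<i) | patternAt-≥ k<i =
      fullMatchᵇ-swapAt-≢ k σ (here refl) i≢k u

    -- `avoids 0` unfolds to `noMatchᵇ α`. At `k = length σ` it has become `noMatchᵇ β`, because all
    -- tested positions lie below the length.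
    avoids : ℕ → List ℕ → Bool
    avoids k σ = countᵇ (λ i → fullMatchᵇ (patternAt k i) σ i) (upTo (length σ)) ≡ᵇ 0

    avoids-swapAt : ∀ k σ → Unique σ → avoids k (swapAt k σ) ≡ avoids (suc k) σ
    avoids-swapAt k σ u rewrite ↭-length (swapAt-↭ k σ) =
      cong (_≡ᵇ 0) (countᵇ-cong (upTo (length σ)) λ {i} _ → fullMatchᵇ-patternAt k σ i u)

    avoids-all : ∀ σ → avoids (length σ) σ ≡ noMatchᵇ β σ
    avoids-all σ = cong (_≡ᵇ 0) (countᵇ-cong (upTo (length σ)) λ {i} i∈ →
      cong (λ τ → fullMatchᵇ τ σ i) (patternAt-< (∈-upTo⁻ i∈)))

    equidistributed : (f : List ℕ → Bool) → (∀ k σ → f (swapAt k σ) ≡ f σ) → ∀ n →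
      countᵇ (λ σ → noMatchᵇ α σ ∧ f σ) (S n) ≡ countᵇ (λ σ → noMatchᵇ β σ ∧ f σ) (S n)
    equidistributed f f-inv n = trans (hybrid n) (countᵇ-cong (S n) λ {σ} σ∈ →
      cong (_∧ f σ) (trans (cong (λ k → avoids k σ) (sym (proj₁ (∈-S⁻ n σ∈)))) (avoids-all σ)))
      where
      hybrid : ∀ k → countᵇ (λ σ → avoids 0 σ ∧ f σ) (S n) ≡ countᵇ (λ σ → avoids k σ ∧ f σ) (S n)
      hybrid zero    = refl
      hybrid (suc k) = trans (hybrid k) (trans
        (countᵇ-involution _ (swapAt k) (S-unique n) (λ {σ} → ∈S-resp-↭ n (↭-sym (swapAt-↭ k σ))) (λ {σ} _ → swapAt-involutive k σ))
        (countᵇ-cong (S n) λ {σ} σ∈ → cong₂ _∧_ (avoids-swapAt k σ (∈S⇒Unique n σ∈)) (f-inv k σ)))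

    des-swapAt : ∀ k σ → des (swapAt k σ) ≡ des σ
    des-swapAt = swapAt-invariant des λ e → let open Exchanged e in
      trans (cong des σ≡) (trans (des-twin twin before after) (cong des (sym σ′≡)))

    LRmin-swapAt : ∀ k σ → LRmin (swapAt k σ) ≡ LRmin σ
    LRmin-swapAt = swapAt-invariant LRmin λ e → let open Exchanged e in
      trans (cong LRmin σ≡) (trans (LRmin-twin twin before after) (cong LRmin (sym σ′≡)))

    inv-swapAt : inv α ≡ inv β → ∀ k σ → inv (swapAt k σ) ≡ inv σ
    inv-swapAt inv≡ = swapAt-invariant inv λ e → let open Exchanged e in
      trans (cong inv σ≡) (trans
        (inv-twin twin (trans (sym (inv-red old)) (trans (cong inv red-old) (trans inv≡ (trans (cong inv (sym red-new)) (inv-red new))))) before after)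
        (cong inv (sym σ′≡)))

-- Splitting the two patterns

split-last : ∀ w → 0 < length w → ∃[ u ] w ≡ u ++ (w ! length w) ∷ []
split-last (x ∷ [])    _ = [] , refl
split-last (x ∷ y ∷ w) _ with u , eq ← split-last (y ∷ w) (s≤s z≤n) = x ∷ u , cong (x ∷_) eq

!-++ˡ : ∀ u v i → i ≤ length u → 1 ≤ i → (u ++ v) ! i ≡ u ! i
!-++ˡ (x ∷ u) v (suc zero)    _  _ = refl
!-++ˡ (x ∷ u) v (suc (suc i)) le _ = !-++ˡ u v (suc i) (s≤s⁻¹ le) (s≤s z≤n)

split-common : ∀ a v w → 1 ≤ a → a ≤ length v → a ≤ length w → (∀ i → 1 ≤ i → i ≤ a → v ! i ≡ w ! i) →
  ∃[ u ] ∃[ v′ ] ∃[ w′ ] v ≡ u ++ (v ! a) ∷ v′ × w ≡ u ++ (v ! a) ∷ w′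
split-common (suc zero) (x ∷ v) (y ∷ w) _ _ _ agree = [] , v , w , refl , cong (_∷ w) (sym (agree 1 ≤-refl ≤-refl))
split-common (suc (suc a)) (x ∷ v) (y ∷ w) _ le le′ agree
  with u , v′ , w′ , eq , eq′ ← split-common (suc a) v w (s≤s z≤n) (s≤s⁻¹ le) (s≤s⁻¹ le′)
         (λ { (suc i) 1≤ i≤ → agree (suc (suc i)) (s≤s z≤n) (s≤s i≤) }) =
  x ∷ u , v′ , w′ , cong (x ∷_) eq , cong₂ _∷_ (sym (agree 1 ≤-refl (s≤s z≤n))) eq′

split-patterns : ∀ j a v w → length v ≡ j → length w ≡ j → 1 ≤ a → a < j →
  (∀ i → 1 ≤ i → i ≤ a → v ! i ≡ w ! i) → v ! j ≡ w ! j →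
  ∃[ u ] ∃[ v′ ] ∃[ w′ ] ∃[ z ] v ≡ u ++ (v ! a) ∷ v′ ++ z ∷ [] × w ≡ u ++ (v ! a) ∷ w′ ++ z ∷ []
split-patterns j a v w lenv lenw 1≤a a<j agree last =
  -- The last entry is removed first; since `a < j`, position `a` survives in what remains, so the 1
  -- and the last entry are distinct places.
  let v₁ , eqv = split-last v (subst (0 <_) (sym lenv) (≤-<-trans z≤n a<j))
      w₁ , eqw = split-last w (subst (0 <_) (sym lenw) (≤-<-trans z≤n a<j))
      a≤v₁ = a≤ eqv lenv
      a≤w₁ = a≤ eqw lenw
      u , v′ , w′ , eqv₁ , eqw₁ = split-common a v₁ w₁ 1≤a a≤v₁ a≤w₁ λ i 1≤i i≤a →
        trans (sym (entry eqv (≤-trans i≤a a≤v₁) 1≤i)) (trans (agree i 1≤i i≤a) (entry eqw (≤-trans i≤a a≤w₁) 1≤i))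
      same = sym (entry eqv a≤v₁ 1≤a)
  in u , v′ , w′ , v ! j
     , glue eqv eqv₁ same (cong (v !_) lenv)
     , glue eqw eqw₁ same (trans (cong (w !_) lenw) (sym last))
  where
  a≤ : ∀ {x y b} → x ≡ y ++ b ∷ [] → length x ≡ j → a ≤ length y
  a≤ {y = y} refl len = s≤s⁻¹ (≤-trans a<j (≤-reflexive (trans (sym len) (trans (length-++ y) (+-comm _ 1)))))

  entry : ∀ {x y b i} → x ≡ y ++ b ∷ [] → i ≤ length y → 1 ≤ i → x ! i ≡ y ! i
  entry {y = y} {b} {i} refl = !-++ˡ y (b ∷ []) i

  glue : ∀ {x y b b′ c c′ p q} → x ≡ y ++ b ∷ [] → y ≡ p ++ c ∷ q → c ≡ c′ → b ≡ b′ → x ≡ p ++ c′ ∷ q ++ b′ ∷ []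
  glue {p = p} refl refl refl refl = ++-assoc p _ _

theorem1p7 : (j : ℕ) → 3 ≤ j → (α β : List ℕ) → α ∈ S j → β ∈ S j
    → MutuallyMinimalOverlapping j α β
    → (a : ℕ) → 1 ≤ a → a < j
    → (∀ i → 1 ≤ i → i ≤ a → α ! i ≡ β ! i)
    → α ! a ≡ 1 → β ! a ≡ 1
    → α ! j ≡ β ! j
    → des α ≡ des β
    → (∀ n d l → coeffDesLR α n d l ≡ coeffDesLR β n d l)
    × (inv α ≡ inv β → ∀ n d k l → coeffDesInvLR α n d k l ≡ coeffDesInvLR β n d k l)
theorem1p7 j 3≤j α β α∈ β∈ (minα , minβ , (σ , σ∈ , α-mch , _) , minαβ) a 1≤a a<j agree α!a β!a last des≡
  -- The entry `α ! a` is abstracted and replaced by 1 before unification, so that both patterns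
  -- take the shape fixed in `Patterns`.
  with pre , m , m′ , z , refl , refl ← subst (λ b → ∃[ u ] ∃[ v ] ∃[ w ] ∃[ z ] α ≡ u ++ b ∷ v ++ z ∷ [] × β ≡ u ++ b ∷ w ++ z ∷ [])
         α!a (split-patterns j a α β (proj₁ (∈-S⁻ j α∈)) (proj₁ (∈-S⁻ j β∈)) 1≤a a<j agree last)
  with refl , _ ← ∈-S⁻ j α∈ =
    (λ n d l → equidistributed (λ σ → (des σ ≡ᵇ d) ∧ (LRmin σ ≡ᵇ l))
      (λ k σ → cong₂ (λ d′ l′ → (d′ ≡ᵇ d) ∧ (l′ ≡ᵇ l)) (des-swapAt k σ) (LRmin-swapAt k σ)) n)
  , λ inv≡ n d i l → equidistributed (λ σ → (des σ ≡ᵇ d) ∧ (inv σ ≡ᵇ i) ∧ (LRmin σ ≡ᵇ l))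
      (λ k σ → cong₂ _∧_ (cong (_≡ᵇ d) (des-swapAt k σ))
        (cong₂ _∧_ (cong (_≡ᵇ i) (inv-swapAt inv≡ k σ)) (cong (_≡ᵇ l) (LRmin-swapAt k σ)))) n
  where
  0<j : 0 < j
  0<j = ≤-trans (s≤s z≤n) 3≤j

  lenα : length α ≡ j
  lenα = proj₁ (∈-S⁻ j α∈)

  lenβ : length β ≡ j
  lenβ = proj₁ (∈-S⁻ j β∈)

  α≢β : α ≢ β
  -- The existence half of mutual minimal overlapping supplies a match of α; were the patterns
  -- equal, it would also match β at distance 0, inside a permutation of length `j`, which is too
  -- short.
  α≢β α≡β with i , mi ← mch-positive⁻ lenα α-mch =
    mutuallyMinimalOverlapping⇒apart 0<j lenα lenβ minαβ (∈S⇒Unique (2 * j ∸ 1) σ∈) i (<-≤-trans (s≤s (s≤s z≤n)) 3≤j)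
      mi (subst (Match j β σ) (sym (+-identityʳ i)) (trans mi α≡β))

  apart : ∀ {τ τ′ σ} → τ ∈ α ∷ β ∷ [] → τ′ ∈ α ∷ β ∷ [] → Unique σ →
    ∀ i {d} → 0 < d → suc d < j → Match j τ σ i → ¬ Match j τ′ σ (i + d)
  apart (here refl)         (here refl)         u i 0<d d< = minimalOverlapping⇒apart 0<j minα lenα u i 0<d d<
  apart (here refl)         (there (here refl)) u i _   d< = mutuallyMinimalOverlapping⇒apart 0<j lenα lenβ minαβ u i d<
  apart (there (here refl)) (here refl)         u i _   d< =
    mutuallyMinimalOverlapping⇒apart 0<j lenβ lenα (λ n n< σ σ∈ b a → minαβ n n< σ σ∈ a b) u i d<
  apart (there (here refl)) (there (here refl)) u i 0<d d< = minimalOverlapping⇒apart 0<j minβ lenβ u i 0<d d<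

  open Patterns.Exchange pre m m′ z (↭-trans (S⇒↭oneTo j α∈) (↭-sym (S⇒↭oneTo j β∈))) des≡ α≢β apart
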